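{- For every integer $q\ge 3$ there is a constant $C_q>0$ (depending at most on $q$, not on $n$ or $\delta$) such that for every integer $n\ge 2$, every $\delta>0$, and every $q$-LCS $\mathcal S$ on $[n]$ with error-tolerance $\delta$, $$\mathrm{rank}(\mathcal S)\le C_q\,\delta^{ -\frac{1}{q-1}}\, n^{\frac{q-2}{q-1}}\log_2 n .$$
   Context: A spanoid $\mathcal S$ on $[n]=\{1,\dots,n\}$ is a family of pairs $(S,i)$ with $S\subseteq[n]$, $i\in[n]$ (rules, written $S\to i$). For $T\subseteq[n]$ and $i\in[n]$ write $T\models i$ if there is a sequence $T=T_0,T_1,\dots,T_r$ ($r\ge 0$) with $i\in T_r$ such that for each $j\in[r]$, $T_j=T_{j-1}\cup\{i_j\}$ for some $i_j\in[n]$ for which there is $S\subseteq T_{j-1}$ with $(S,i_j)\in\mathcal S$. $\mathrm{span}(T)=\{i: T\models i\}$, and $\mathrm{rank}(\mathcal S)$ is the minimum size of $T\subseteq[n]$ with $\mathrm{span}(T)=[n]$. A spanoid $\mathcal S$ on $[n]$ is a $q$-LCS with error-tolerance $\delta$ if for every $i\in[n]$ there is a family $M_i$ of at least $\delta n$ pairwise disjoint $q$-element subsets of $[n]$ such that $(S,i)\in\mathcal S$ for every $S\in M_i$. -}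

module Defs where

open import Data.Nat as ℕ using (ℕ; suc; _^_; _≥_)
open import Data.Integer using (+_)
open import Data.Fin using (Fin)
open import Data.Fin.Subset using (Subset; _∪_; _∩_; ⁅_⁆; _⊆_; _∈_; ∣_∣; Empty)
open import Data.Rational as ℚ using (ℚ; _/_)
open import Data.List using (List; length)
open import Data.List.Relation.Unary.All using (All)
open import Data.List.Relation.Unary.AllPairs using (AllPairs)
open import Data.Product using (Σ; ∃; _×_)
open import Relation.Binary.PropositionalEquality using (_≡_)

ℕ→ℚ : ℕ → ℚ
ℕ→ℚ m = (+ m) / 1

-- A spanoid on [n] = Fin n: a family of rules (S , i), given as a predicate.
Spanoid : ℕ → Set₁
Spanoid n = Subset n → Fin n → Set

data Reach {n : ℕ} (𝒮 : Spanoid n) (T : Subset n) : Subset n → Set where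
  start : Reach 𝒮 T T
  step  : ∀ {T' : Subset n} (S : Subset n) (j : Fin n) →
          Reach 𝒮 T T' → S ⊆ T' → 𝒮 S j → Reach 𝒮 T (T' ∪ ⁅ j ⁆)

_⊨[_]_ : ∀ {n} → Subset n → Spanoid n → Fin n → Set
T ⊨[ 𝒮 ] i = ∃ λ T' → Reach 𝒮 T T' × i ∈ T'

Spanning : ∀ {n} → Spanoid n → Subset n → Set
Spanning 𝒮 T = ∀ i → T ⊨[ 𝒮 ] i

IsRank : ∀ {n} → Spanoid n → ℕ → Set
IsRank 𝒮 r = (∃ λ T → Spanning 𝒮 T × ∣ T ∣ ≡ r)
           × (∀ T → Spanning 𝒮 T → r ℕ.≤ ∣ T ∣)

Disjoint : ∀ {n} → Subset n → Subset n → Set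
Disjoint A B = Empty (A ∩ B)

-- 𝒮 is a q-LCS with error-tolerance δ: every i has a family M_i (a list of
-- pairwise disjoint q-element subsets, hence of distinct sets) of size ≥ δ n
-- with S → i a rule for each S ∈ M_i.
IsLCS : ∀ {n} → ℕ → ℚ → Spanoid n → Set
IsLCS {n} q δ 𝒮 = ∀ (i : Fin n) → Σ (List (Subset n)) λ M →
     All (λ S → ∣ S ∣ ≡ q) M
   × AllPairs Disjoint M
   × All (λ S → 𝒮 S i) M
   × (δ ℚ.* ℕ→ℚ n ℚ.≤ ℕ→ℚ (length M))

-- u ≤ v · (log₂ n)^k  for rationals u and v > 0, k ≥ 1, n ≥ 1.
-- Encoded without reals: every nonnegative rational t = a/b with t^k · v < u
-- satisfies t ≤ log₂ n, i.e. 2^a ≤ n^b.  (Equivalent since log₂ n ≥ 0 and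
-- the rationals are dense.)
LeTimesLog2Pow : ℚ → ℚ → ℕ → ℕ → Set
LeTimesLog2Pow u v k n = ∀ (a b : ℕ) → b ≥ 1 →
  ℕ→ℚ (a ^ k) ℚ.* v ℚ.< u ℚ.* ℕ→ℚ (b ^ k) → 2 ^ a ℕ.≤ n ^ b

{-# OPTIONS --safe #-}
module Submission where

open import Defs
open import Data.Bool using (Bool; T; true; false; not; _∧_; _∨_)
open import Data.Bool.Properties as Bool using (∧-zeroʳ; ¬-not)
open import Data.Nat hiding (∣_-_∣; _>_)
open import Data.Nat.Properties
open import Data.Nat.Tactic.RingSolver using (solve-∀)
open import Data.Rational using (ℚ; _>_; 0ℚ)
import Data.Rational
import Data.Rational as ℚ
import Data.Rational.Properties as ℚ
import Data.Rational.Unnormalised as ℚᵘ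
import Data.Rational.Unnormalised.Properties as ℚᵘ
import Data.Integer as ℤ
import Data.Integer.Properties as ℤ
open import Data.Product using (Σ; ∃; _×_; _,_; proj₁; proj₂)
open import Data.Sum using (_⊎_; inj₁; inj₂; [_,_]′; map₂)
open import Data.Fin using (Fin; zero; suc)
open import Data.Fin.Subset using (Subset; inside; outside; _∪_; ⁅_⁆; _⊆_; _∈_; _∉_; ∣_∣; ⊥; _-_; Nonempty)
open import Data.Fin.Subset.Properties
open import Data.Fin.Properties as Fin using ()
open import Data.Vec using ([]; _∷_; tabulate; here; there)
open import Data.Vec.Properties using (lookup∘tabulate; lookup⇒[]=)
open import Data.List using (List; []; _∷_; length; allFin)
open import Data.List.Membership.Propositional.Properties using (∈-allFin)
open import Data.List.Relation.Unary.All as All using (All; []; _∷_)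
open import Data.List.Relation.Unary.Any using (Any; any?)
open import Data.List.Relation.Unary.AllPairs using (AllPairs; []; _∷_)
open import Relation.Nullary using (yes; no; does; contradiction)
open import Relation.Nullary.Decidable using (dec-true)
open import Relation.Binary.PropositionalEquality
open import Function using (_∘_; id; case_of_)
open import Algebra.Properties.Semiring.Sum +-*-semiring
  using (sum; ∑-distrib-+; ∑-comm; sum-cong-≗; *-distribˡ-sum)

-- Write q = k + 1 and let t be of order d^(1/k), where d is the least size of the families Mᵢ.
-- We keep a set A and a core K such that every s ∈ [n] is derivable from A together with one
-- point f(s) ∈ K; initially A = ∅, K = [n], f = id.  While |K| ≥ 2n/tᵏ, at least half of the
-- core is light, i.e. has a fibre of fewer than tᵏ points, so that at least tᵏ of the rules
-- in Mᵢ contain some s with f(s) ≠ i.  A random A′ of density 1/t contains S ∖ {s} for one of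
-- them with probability at least 1/2, and then i is derivable from A ∪ A′ ∪ {f(s)}: this is an
-- arrow i → f(s) inside the core.  Keeping the arrows that cross a random cut, a constant
-- fraction of the core becomes redundant at the cost of O(n/t) new points of A, so O(log n)
-- rounds leave a spanning set of size O(n log n / t).

-- Indicators, finite sums and expectations over random subsets.

𝟙 : Bool → ℕ
𝟙 true  = 1
𝟙 false = 0

𝟙-∧ : ∀ a b → 𝟙 (a ∧ b) ≡ 𝟙 a * 𝟙 b
𝟙-∧ true  b = sym (+-identityʳ _)
𝟙-∧ false b = refl

𝟙-not : ∀ a → 𝟙 (not a) + 𝟙 a ≡ 1
𝟙-not true  = refl
𝟙-not false = refl

sum-mono-≤ : ∀ {n} {f g : Fin n → ℕ} → (∀ i → f i ≤ g i) → sum f ≤ sum g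
sum-mono-≤ {zero}  f≤g = z≤n
sum-mono-≤ {suc n} f≤g = +-mono-≤ (f≤g zero) (sum-mono-≤ (f≤g ∘ suc))

sum-const : ∀ n c → sum {n} (λ _ → c) ≡ n * c
sum-const zero    c = refl
sum-const (suc n) c = cong (c +_) (sum-const n c)

-- Each element lies in a random subset with probability 1/(1+u), independently;
-- W u n Φ is the expectation of Φ scaled by (1+u)ⁿ.
W : ℕ → ∀ n → (Subset n → ℕ) → ℕ
W u zero    Φ = Φ []
W u (suc n) Φ = u * W u n (λ A → Φ (outside ∷ A)) + W u n (λ A → Φ (inside ∷ A))

module _ (u : ℕ) where

  W-cong : ∀ n {Φ Ψ : Subset n → ℕ} → (∀ A → Φ A ≡ Ψ A) → W u n Φ ≡ W u n Ψ
  W-cong zero    Φ≡Ψ = Φ≡Ψ []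
  W-cong (suc n) Φ≡Ψ = cong₂ (λ x y → u * x + y) (W-cong n (λ A → Φ≡Ψ _)) (W-cong n (λ A → Φ≡Ψ _))

  W-+ : ∀ n (Φ Ψ : Subset n → ℕ) → W u n (λ A → Φ A + Ψ A) ≡ W u n Φ + W u n Ψ
  W-+ zero    Φ Ψ = refl
  W-+ (suc n) Φ Ψ
    rewrite W-+ n (λ A → Φ (outside ∷ A)) (λ A → Ψ (outside ∷ A))
          | W-+ n (λ A → Φ (inside ∷ A)) (λ A → Ψ (inside ∷ A)) = lem u _ _ _ _
    where
    lem : ∀ u a b c d → u * (a + b) + (c + d) ≡ (u * a + c) + (u * b + d)
    lem = solve-∀

  W-* : ∀ n c (Φ : Subset n → ℕ) → W u n (λ A → c * Φ A) ≡ c * W u n Φ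
  W-* zero    c Φ = refl
  W-* (suc n) c Φ
    rewrite W-* n c (λ A → Φ (outside ∷ A)) | W-* n c (λ A → Φ (inside ∷ A)) = lem u c _ _
    where
    lem : ∀ u c a b → u * (c * a) + c * b ≡ c * (u * a + b)
    lem = solve-∀

  W-const : ∀ n c → W u n (λ _ → c) ≡ suc u ^ n * c
  W-const zero    c = sym (+-identityʳ c)
  W-const (suc n) c rewrite W-const n c = lem u (suc u ^ n) c
    where
    lem : ∀ u p c → u * (p * c) + p * c ≡ (p + u * p) * c
    lem = solve-∀

  W-sum : ∀ n m (Φ : Fin m → Subset n → ℕ) →
    W u n (λ A → sum (λ i → Φ i A)) ≡ sum (λ i → W u n (Φ i))
  W-sum n zero    Φ = trans (W-const n 0) (*-zeroʳ (suc u ^ n))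
  W-sum n (suc m) Φ =
    trans (W-+ n (Φ zero) _) (cong (W u n (Φ zero) +_) (W-sum n m (Φ ∘ suc)))

  -- Every element contributes 1/(1+u) to the mean size; the factor `suc u` clears this denominator.
  W-size : ∀ n → suc u * W u n ∣_∣ ≡ n * suc u ^ n
  W-size zero    = *-zeroʳ (suc u)
  W-size (suc n) rewrite W-+ n (λ _ → 1) ∣_∣ | W-const n 1 =
    trans (lem₁ u (W u n ∣_∣) (suc u ^ n))
      (trans (cong (λ x → suc u * (x + suc u ^ n)) (W-size n)) (lem₂ u n (suc u ^ n)))
    where
    lem₁ : ∀ u w p → suc u * (u * w + (p * 1 + w)) ≡ suc u * (suc u * w + p)
    lem₁ = solve-∀
    lem₂ : ∀ u n p → suc u * (n * p + p) ≡ suc n * (suc u * p)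
    lem₂ = solve-∀

  -- The first-moment method by conditional expectations: if the inequality of means fails on the
  -- `outside` branch, the `inside` branch has to make up for it.
  W-witness : ∀ n {Φ Ψ : Subset n → ℕ} → W u n Φ ≤ W u n Ψ → ∃ λ A → Φ A ≤ Ψ A
  W-witness zero    p = [] , p
  W-witness (suc n) {Φ} {Ψ} p
    with W u n (λ A → Φ (outside ∷ A)) ≤? W u n (λ A → Ψ (outside ∷ A))
  ... | yes q = let A , r = W-witness n q in outside ∷ A , r
  ... | no ¬q = let A , r = W-witness n (+-cancelˡ-≤ (u * W u n (λ A → Ψ (outside ∷ A))) _ _
                              (≤-trans (+-monoˡ-≤ _ (*-monoʳ-≤ u (<⇒≤ (≰⇒> ¬q)))) p))
                in inside ∷ A , r

  -- The event S ⊆ A is independent of every quantity that ignores A ∩ S.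
  W-hit : ∀ {n} (S : Subset n) (Ψ : Subset n → ℕ) → (∀ A → Ψ A ≡ Ψ (A ∪ S)) →
    W u n (λ A → 𝟙 (does (S ⊆? A)) * Ψ A) * suc u ^ ∣ S ∣ ≡ W u n Ψ
  W-hit []            Ψ inv = trans (*-identityʳ _) (+-identityʳ _)
  W-hit {suc n} (outside ∷ S) Ψ inv =
    trans (lem u _ _ (suc u ^ ∣ S ∣))
      (cong₂ (λ x y → u * x + y) (W-hit S _ (λ A → inv (outside ∷ A))) (W-hit S _ (λ A → inv (inside ∷ A))))
    where
    lem : ∀ u a b p → (u * a + b) * p ≡ u * (a * p) + b * p
    lem = solve-∀
  -- The `outside` branch of the event vanishes. The extra factor `suc u` replaces it, because `inv`
  -- sends `inside ∷ A` and `outside ∷ A` to the same union and so `Ψ` agrees on both.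
  W-hit {suc n} (inside ∷ S) Ψ inv
    rewrite W-const n 0 | *-zeroʳ (suc u ^ n) | *-zeroʳ u =
    trans (lem₁ u (W u n (λ A → 𝟙 (does (S ⊆? A)) * Ψ (inside ∷ A))) (suc u ^ ∣ S ∣))
      (trans (cong (suc u *_) (W-hit S (λ A → Ψ (inside ∷ A)) (λ A → inv (inside ∷ A))))
        (trans (+-comm _ (u * _)) (cong (λ x → u * x + W u n (λ A → Ψ (inside ∷ A)))
          (W-cong n (λ A → trans (inv (inside ∷ A)) (sym (inv (outside ∷ A))))))))
    where
    lem₁ : ∀ u x p → x * (suc u * p) ≡ suc u * (x * p)
    lem₁ = solve-∀

  -- Complement of `W-hit`: a hit takes the share 1/(N+1), a miss the rest. Writing the power as
  -- `suc N` avoids subtraction.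
  W-miss : ∀ {n} (S : Subset n) (Ψ : Subset n → ℕ) → (∀ A → Ψ A ≡ Ψ (A ∪ S)) →
    ∀ N → suc u ^ ∣ S ∣ ≡ suc N →
    W u n (λ A → 𝟙 (not (does (S ⊆? A))) * Ψ A) * suc N ≡ N * W u n Ψ
  W-miss {n} S Ψ inv N eq = +-cancelʳ-≡ (W u n Ψ) _ _ (begin
    x * suc N + W u n Ψ             ≡⟨ cong (x * suc N +_) (trans (sym (W-hit S Ψ inv)) (cong (y *_) eq)) ⟩
    x * suc N + y * suc N           ≡⟨ *-distribʳ-+ (suc N) x y ⟨
    (x + y) * suc N                 ≡⟨ cong (_* suc N) (W-+ n _ _) ⟨
    W u n (λ A → 𝟙 (not (does (S ⊆? A))) * Ψ A + 𝟙 (does (S ⊆? A)) * Ψ A) * suc N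
      ≡⟨ cong (_* suc N) (W-cong n (λ A → trans (sym (*-distribʳ-+ (Ψ A) (𝟙 (not (does (S ⊆? A)))) (𝟙 (does (S ⊆? A)))))
           (trans (cong (_* Ψ A) (𝟙-not (does (S ⊆? A)))) (+-identityʳ _)))) ⟩
    W u n Ψ * suc N                 ≡⟨ lem (W u n Ψ) N ⟩
    N * W u n Ψ + W u n Ψ           ∎)
    where
    open ≡-Reasoning
    x = W u n (λ A → 𝟙 (not (does (S ⊆? A))) * Ψ A)
    y = W u n (λ A → 𝟙 (does (S ⊆? A)) * Ψ A)
    lem : ∀ w N → w * suc N ≡ N * w + w
    lem = solve-∀

-- Hitting some member of a disjoint family.

someIn : ∀ {n} → List (Subset n) → Subset n → Bool
someIn G A = does (any? (_⊆? A) G)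

⊆?-∪-disjoint : ∀ {n} (S T A : Subset n) → Disjoint S T → does (T ⊆? A) ≡ does (T ⊆? (A ∪ S))
⊆?-∪-disjoint S T A d with T ⊆? A | T ⊆? (A ∪ S)
... | yes _ | yes _ = refl
... | no _  | no _  = refl
... | yes p | no ¬q = contradiction (λ {x} x∈T → x∈p∪q⁺ (inj₁ (p x∈T))) ¬q
... | no ¬p | yes q = contradiction (λ {x} x∈T → side (x∈p∪q⁻ A S (q x∈T)) x∈T) ¬p
  where
  side : ∀ {x} → x ∈ A ⊎ x ∈ S → x ∈ T → x ∈ A
  side (inj₁ a) _ = a
  side (inj₂ s) t = contradiction (_ , x∈p∩q⁺ (s , t)) d

-- This is the invariance that `W-miss` asks of `Ψ` when the sets of a disjoint family are peeled
-- off one by one.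
someIn-∪-disjoint : ∀ {n} (S : Subset n) G A → All (Disjoint S) G → someIn G A ≡ someIn G (A ∪ S)
someIn-∪-disjoint S []      A []       = refl
someIn-∪-disjoint S (T ∷ G) A (d ∷ ds) =
  cong₂ _∨_ (⊆?-∪-disjoint S T A d) (someIn-∪-disjoint S G A ds)

not-∨ : ∀ a b → not (a ∨ b) ≡ not a ∧ not b
not-∨ true  b = refl
not-∨ false b = refl

-- Disjoint sets are missed independently, each with probability N/(N+1), so the probabilities
-- multiply.
W-missAll : ∀ u {n} k N → suc u ^ k ≡ suc N → (G : List (Subset n)) →
  AllPairs Disjoint G → All (λ S → ∣ S ∣ ≡ k) G →
  W u n (λ A → 𝟙 (not (someIn G A))) * suc N ^ length G ≡ N ^ length G * suc u ^ n
W-missAll u {n} k N eq []      _        _        =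
  trans (*-identityʳ _) (trans (W-const u n 1) (*-comm _ 1))
W-missAll u {n} k N eq (S ∷ G) (d ∷ ds) (c ∷ cs) = begin
  W u n (λ A → 𝟙 (not (someIn (S ∷ G) A))) * (suc N * suc N ^ length G)
    ≡⟨ cong (_* (suc N * suc N ^ length G)) (W-cong u n (λ A →
         trans (cong 𝟙 (not-∨ (does (S ⊆? A)) (someIn G A))) (𝟙-∧ (not (does (S ⊆? A))) (not (someIn G A))))) ⟩
  W u n (λ A → 𝟙 (not (does (S ⊆? A))) * 𝟙 (not (someIn G A))) * (suc N * suc N ^ length G)
    ≡⟨ *-assoc (W u n (λ A → 𝟙 (not (does (S ⊆? A))) * 𝟙 (not (someIn G A)))) (suc N) (suc N ^ length G) ⟨
  W u n (λ A → 𝟙 (not (does (S ⊆? A))) * 𝟙 (not (someIn G A))) * suc N * suc N ^ length G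
    ≡⟨ cong (_* suc N ^ length G) (W-miss u S _
         (λ A → cong (𝟙 ∘ not) (someIn-∪-disjoint S G A d)) N (trans (cong (suc u ^_) c) eq)) ⟩
  N * W u n (λ A → 𝟙 (not (someIn G A))) * suc N ^ length G
    ≡⟨ *-assoc N _ _ ⟩
  N * (W u n (λ A → 𝟙 (not (someIn G A))) * suc N ^ length G)
    ≡⟨ cong (N *_) (W-missAll u k N eq G ds cs) ⟩
  N * (N ^ length G * suc u ^ n)
    ≡⟨ *-assoc N _ _ ⟨
  N * N ^ length G * suc u ^ n ∎
  where open ≡-Reasoning

-- Bernoulli's inequality 1 + m/x ≤ (1 + 1/x)^m with the denominators cleared.
bernoulli : ∀ x m → x ^ m * (x + m) ≤ x * suc x ^ m
bernoulli x zero    = ≤-reflexive (lem x)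
  where
  lem : ∀ x → 1 * (x + 0) ≡ x * 1
  lem = solve-∀
bernoulli x (suc m) = begin
  x * p * (x + suc m)               ≤⟨ m≤m+n _ (p * m) ⟩
  x * p * (x + suc m) + p * m       ≡⟨ lem₁ x m p ⟩
  suc x * (p * (x + m))             ≤⟨ *-monoʳ-≤ (suc x) (bernoulli x m) ⟩
  suc x * (x * suc x ^ m)           ≡⟨ lem₂ x (suc x ^ m) ⟩
  x * (suc x * suc x ^ m)           ∎
  where
  open ≤-Reasoning
  p = x ^ m
  lem₁ : ∀ x m p → x * p * (x + suc m) + p * m ≡ suc x * (p * (x + m))
  lem₁ = solve-∀
  lem₂ : ∀ x q → suc x * (x * q) ≡ x * (suc x * q)
  lem₂ = solve-∀

-- In `bernoulli` the factor N + m is at least 2N once m ≥ N.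
two-pow : ∀ N m → suc N ≤ m → 2 * N ^ m ≤ suc N ^ m
two-pow zero    (suc m) _ = z≤n
two-pow (suc x) m       h = *-cancelˡ-≤ (suc x) (begin
  suc x * (2 * p)        ≡⟨ lem (suc x) p ⟩
  p * (suc x + suc x)    ≤⟨ *-monoʳ-≤ p (+-monoʳ-≤ (suc x) (<⇒≤ h)) ⟩
  p * (suc x + m)        ≤⟨ bernoulli (suc x) m ⟩
  suc x * suc (suc x) ^ m ∎)
  where
  open ≤-Reasoning
  p = suc x ^ m
  lem : ∀ a p → a * (2 * p) ≡ p * (a + a)
  lem = solve-∀

-- (1 - 1/N)^N ≤ 1/2, so at least N independent events of probability 1/N cover half of the space.
W-someIn : ∀ u {n} k (G : List (Subset n)) → AllPairs Disjoint G → All (λ S → ∣ S ∣ ≡ k) G →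
  suc u ^ k ≤ length G → suc u ^ n ≤ 2 * W u n (λ A → 𝟙 (someIn G A))
W-someIn u {n} k G ds cs h with suc u ^ k in eq | m^n≢0 (suc u) k
... | suc N | _ = +-cancelˡ-≤ P _ _ (begin
  P + P                       ≡⟨ lem P ⟩
  2 * P                       ≡⟨ cong (2 *_) total ⟨
  2 * (miss + hit)            ≡⟨ *-distribˡ-+ 2 miss hit ⟩
  2 * miss + 2 * hit          ≤⟨ +-monoˡ-≤ (2 * hit) miss≤ ⟩
  P + 2 * hit                 ∎)
  where
  open ≤-Reasoning
  P    = suc u ^ n
  m    = length G
  miss = W u n (λ A → 𝟙 (not (someIn G A)))
  hit  = W u n (λ A → 𝟙 (someIn G A))
  lem : ∀ p → p + p ≡ 2 * p
  lem = solve-∀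
  total : miss + hit ≡ P
  total = trans (sym (W-+ u n _ _))
    (trans (W-cong u n (λ A → 𝟙-not (someIn G A))) (trans (W-const u n 1) (*-identityʳ P)))
  miss≤ : 2 * miss ≤ P
  miss≤ = *-cancelʳ-≤ (2 * miss) P (suc N ^ m) {{m^n≢0 (suc N) m}} (begin
    2 * miss * suc N ^ m      ≡⟨ *-assoc 2 miss _ ⟩
    2 * (miss * suc N ^ m)    ≡⟨ cong (2 *_) (W-missAll u k N eq G ds cs) ⟩
    2 * (N ^ m * P)           ≡⟨ *-assoc 2 (N ^ m) P ⟨
    2 * N ^ m * P             ≤⟨ *-monoˡ-≤ P (two-pow N m h) ⟩
    suc N ^ m * P             ≡⟨ *-comm _ P ⟩
    P * suc N ^ m             ∎)

-- Derivation trees and reachability.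

-- Trees impose no order on the steps, so derivations compose by substitution. The leaves are given
-- by a predicate, so that "`A` and one more point" needs no set of its own.
data Derives {n} (𝒮 : Spanoid n) (P : Fin n → Set) : Fin n → Set where
  base : ∀ {i} → P i → Derives 𝒮 P i
  rule : ∀ {i} (S : Subset n) → 𝒮 S i → (∀ x → x ∈ S → Derives 𝒮 P x) → Derives 𝒮 P i

Derives-bind : ∀ {n} {𝒮 : Spanoid n} {P Q : Fin n → Set} →
  (∀ x → P x → Derives 𝒮 Q x) → ∀ {i} → Derives 𝒮 P i → Derives 𝒮 Q i
Derives-bind f (base p)     = f _ p
Derives-bind f (rule S r d) = rule S r (λ x x∈S → Derives-bind f (d x x∈S))

module _ {n} {𝒮 : Spanoid n} {A : Subset n} where

  -- Starting from an arbitrary reached `T` allows extensions to be run one after another.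
  Extension : (Subset n → Set) → Set
  Extension P = ∀ {T} → Reach 𝒮 A T → ∃ λ T′ → T ⊆ T′ × Reach 𝒮 A T′ × P T′

  gather : (S : Subset n) → (∀ x → x ∈ S → Extension (x ∈_)) →
    (xs : List (Fin n)) → Extension (λ T → All (λ x → x ∈ S → x ∈ T) xs)
  gather S h []       r = _ , id , r , []
  gather S h (x ∷ xs) r with x ∈? S | gather S h xs r
  ... | no x∉S  | T , T⊆ , r′ , all = T , T⊆ , r′ , (λ x∈S → contradiction x∈S x∉S) ∷ all
  ... | yes x∈S | T , T⊆ , r′ , all =
    let U , T⊆U , r″ , x∈U = h x x∈S r′
    in U , T⊆U ∘ T⊆ , r″ , (λ _ → x∈U) ∷ All.map (λ f → T⊆U ∘ f) all

  -- Linearises a tree: the premises of a rule are reached in turn, each on top of the previous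
  -- ones, and then the rule fires. Nothing is lost since reached sets only grow.
  extend : ∀ {i} → Derives 𝒮 (_∈ A) i → Extension (i ∈_)
  extend (base i∈A) r = _ , id , r , mono r i∈A
    where
    mono : ∀ {T} → Reach 𝒮 A T → A ⊆ T
    mono start          = id
    mono (step _ _ r _ _) = p⊆p∪q _ ∘ mono r
  extend {i} (rule S s d) r =
    let T , T⊆ , r′ , all = gather S (λ x x∈S → extend (d x x∈S)) (allFin n) r
    in T ∪ ⁅ i ⁆ , p⊆p∪q _ ∘ T⊆
       , step S i r′ (λ {x} → All.lookup all (∈-allFin x)) s
       , x∈p∪q⁺ (inj₂ (x∈⁅x⁆ i))

  Derives⇒⊨ : ∀ {i} → Derives 𝒮 (_∈ A) i → A ⊨[ 𝒮 ] i
  Derives⇒⊨ d = let T , _ , r , i∈T = extend d start in T , r , i∈T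

-- Puncturing disjoint families outside a given set.

∣p∣≡suc∣p-x∣ : ∀ {n} {p : Subset n} {x} → x ∈ p → ∣ p ∣ ≡ suc ∣ p - x ∣
∣p∣≡suc∣p-x∣ {p = .true ∷ p} here = cong (suc ∘ ∣_∣) (sym (p─⊥≡p p))
∣p∣≡suc∣p-x∣ {p = false ∷ p} (there x∈p) = ∣p∣≡suc∣p-x∣ x∈p
∣p∣≡suc∣p-x∣ {p = true ∷ p}  (there x∈p) = cong suc (∣p∣≡suc∣p-x∣ x∈p)

nonempty : ∀ {n k} (p : Subset n) → ∣ p ∣ ≡ suc k → Nonempty p
nonempty (true ∷ p)  _  = zero , here
nonempty (false ∷ p) eq = let x , x∈p = nonempty p eq in suc x , there x∈p

⊆⊎∃∉ : ∀ {n} (S F : Subset n) → S ⊆ F ⊎ ∃ λ x → x ∈ S × x ∉ F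
⊆⊎∃∉ []          []          = inj₁ id
⊆⊎∃∉ (s ∷ S) (b ∷ F) with ⊆⊎∃∉ S F
⊆⊎∃∉ (s ∷ S) (b ∷ F)         | inj₂ (x , x∈S , x∉F) = inj₂ (suc x , there x∈S , λ where (there p) → x∉F p)
⊆⊎∃∉ (false ∷ S) (b ∷ F)     | inj₁ S⊆F = inj₁ (λ where (there p) → there (S⊆F p))
⊆⊎∃∉ (true ∷ S) (true ∷ F)   | inj₁ S⊆F = inj₁ (λ where here → here
                                                        (there p) → there (S⊆F p))
⊆⊎∃∉ (true ∷ S) (false ∷ F)  | inj₁ S⊆F = inj₂ (zero , here , λ ())

Disjoint-⊆ : ∀ {n} {U V S T : Subset n} → U ⊆ S → V ⊆ T → Disjoint S T → Disjoint U V
Disjoint-⊆ {U = U} {V} U⊆S V⊆T d (x , x∈) =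
  let x∈U , x∈V = x∈p∩q⁻ U V x∈ in d (x , x∈p∩q⁺ (U⊆S x∈U , V⊆T x∈V))

-- Disjointness allows at most ∣ F ∣ sets of M inside F; each of the others gives up a point
-- outside F.
puncture : ∀ {n k} (P : Subset n → Set) (M : List (Subset n)) (F : Subset n) →
  AllPairs Disjoint M → All (λ S → ∣ S ∣ ≡ suc k) M → All P M →
  ∃ λ G → AllPairs Disjoint G × All (λ S → ∣ S ∣ ≡ k) G
        × All (λ S′ → ∃ λ s → s ∉ F × ∃ λ S → P S × s ∈ S × (∀ x → x ∈ S → x ∈ S′ ⊎ x ≡ s)) G
        × (∀ U → All (Disjoint U) M → All (Disjoint U) G)
        × length M ≤ length G + ∣ F ∣
puncture P []      F _        _        _        = [] , [] , [] , [] , (λ _ _ → []) , z≤n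
puncture P (S ∷ M) F (d ∷ ds) (c ∷ cs) (p ∷ ps) with ⊆⊎∃∉ S F
... | inj₂ (s , s∈S , s∉F) =
  let G , ds′ , cs′ , ps′ , disj , len = puncture P M F ds cs ps in
  (S - s) ∷ G
  -- The clause on `U`, applied to `S` itself, makes `S` disjoint from the punctured tail, and hence
  -- also `S - s`.
  , All.map (Disjoint-⊆ {U = S - s} (p─q⊆p S ⁅ s ⁆) id) (disj S d) ∷ ds′
  , suc-injective (trans (sym (∣p∣≡suc∣p-x∣ s∈S)) c) ∷ cs′
  , (s , s∉F , S , p , s∈S , split) ∷ ps′
  , (λ { U (e ∷ es) → Disjoint-⊆ id (p─q⊆p S ⁅ s ⁆) e ∷ disj U es })
  , s≤s len
  where
  split : ∀ x → x ∈ S → x ∈ S - s ⊎ x ≡ s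
  split x x∈S with x Fin.≟ s
  ... | yes eq = inj₂ eq
  ... | no neq = inj₁ (x∈p∧x≢y⇒x∈p-y x∈S neq)
... | inj₁ S⊆F =
  let x , x∈S = nonempty S c
      -- The lost set `S` is paid for by removing one of its points `x` from `F`. Adding
      -- `Disjoint S T` to the predicate ensures that no later `s` equals `x`, so avoiding `F - x`
      -- amounts to avoiding `F`.
      G , ds′ , cs′ , ps′ , disj , len = puncture (λ T → P T × Disjoint S T) M (F - x) ds cs (All.zip (ps , d))
  in G , ds′ , cs′ , All.map (weaken x∈S) ps′ , (λ { U (e ∷ es) → disj U es })
     , ≤-trans (s≤s len) (≤-reflexive (trans (sym (+-suc (length G) _)) (cong (length G +_) (sym (∣p∣≡suc∣p-x∣ (S⊆F x∈S))))))
  where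
  weaken : ∀ {x} → x ∈ S → ∀ {S′} →
    (∃ λ s → s ∉ F - x × ∃ λ T → (P T × Disjoint S T) × s ∈ T × (∀ y → y ∈ T → y ∈ S′ ⊎ y ≡ s)) →
    (∃ λ s → s ∉ F × ∃ λ T → P T × s ∈ T × (∀ y → y ∈ T → y ∈ S′ ⊎ y ≡ s))
  weaken x∈S (s , s∉ , T , (p , dis) , s∈T , split) =
    s , (λ s∈F → s∉ (x∈p∧x≢y⇒x∈p-y s∈F λ { refl → dis (s , x∈p∩q⁺ (x∈S , s∈T)) }))
    , T , p , s∈T , split

-- Counting fibres and sampling a set.

∣tabulate∣ : ∀ {n} (b : Fin n → Bool) → ∣ tabulate b ∣ ≡ sum (𝟙 ∘ b)
∣tabulate∣ {zero}  b = refl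
∣tabulate∣ {suc n} b with b zero
... | true  = cong suc (∣tabulate∣ (b ∘ suc))
... | false = ∣tabulate∣ (b ∘ suc)

∈-tabulate⁺ : ∀ {n} (b : Fin n → Bool) {x} → b x ≡ true → x ∈ tabulate b
∈-tabulate⁺ b {x} eq = lookup⇒[]= x _ (trans (lookup∘tabulate b x) eq)

sum-≟ : ∀ {n} (j : Fin n) → sum (λ i → 𝟙 (does (j Fin.≟ i))) ≡ 1
sum-≟ {suc n} zero    = cong suc (trans (sum-const n 0) (*-zeroʳ n))
sum-≟ {suc n} (suc j) = sum-≟ j

-- After exchanging the sums, each `s` is counted once, at `f s`.
sum-fibers : ∀ {n} (f : Fin n → Fin n) → sum (λ i → sum (λ s → 𝟙 (does (f s Fin.≟ i)))) ≡ n
sum-fibers {n} f = trans (∑-comm (λ i s → 𝟙 (does (f s Fin.≟ i))))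
  (trans (sum-cong-≗ (sum-≟ ∘ f)) (trans (sum-const n 1) (*-identityʳ n)))

-- Charging ∣ A ∣ against the hits lets a single A be both small and hit often.
sample : ∀ u {n} (L : Fin n → Bool) (h : Fin n → Subset n → Bool) →
  (∀ i → suc u ^ n * 𝟙 (L i) ≤ 2 * W u n (𝟙 ∘ h i)) →
  ∃ λ A → sum (𝟙 ∘ L) * n + sum (𝟙 ∘ L) * (suc u * ∣ A ∣) ≤ 4 * n * sum (λ i → 𝟙 (h i A))
sample u {n} L h hyp = W-witness u n (begin
  W u n (λ A → ℓ * n + ℓ * (suc u * ∣ A ∣))
    ≡⟨ W-+ u n _ _ ⟩
  W u n (λ _ → ℓ * n) + W u n (λ A → ℓ * (suc u * ∣ A ∣))
    ≡⟨ cong₂ _+_ (W-const u n (ℓ * n)) (trans (W-* u n ℓ _) (cong (ℓ *_) (trans (W-* u n (suc u) _) (W-size u n)))) ⟩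
  -- Both terms have mean ℓn. The mean number of hits is at least ℓ/2, so the weight 4n covers the
  -- total 2ℓn.
  P * (ℓ * n) + ℓ * (n * P)
    ≡⟨ lem₁ P ℓ n ⟩
  2 * n * (P * ℓ)
    ≡⟨ cong (2 * n *_) (*-distribˡ-sum P (𝟙 ∘ L)) ⟩
  2 * n * sum (λ i → P * 𝟙 (L i))
    ≤⟨ *-monoʳ-≤ (2 * n) (sum-mono-≤ hyp) ⟩
  2 * n * sum (λ i → 2 * W u n (𝟙 ∘ h i))
    ≡⟨ cong (2 * n *_) (*-distribˡ-sum 2 (λ i → W u n (𝟙 ∘ h i))) ⟨
  2 * n * (2 * sum (λ i → W u n (𝟙 ∘ h i)))
    ≡⟨ lem₂ n _ ⟩
  4 * n * sum (λ i → W u n (𝟙 ∘ h i))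
    ≡⟨ cong (4 * n *_) (W-sum u n n (λ i → 𝟙 ∘ h i)) ⟨
  4 * n * W u n (λ A → sum (λ i → 𝟙 (h i A)))
    ≡⟨ W-* u n (4 * n) _ ⟨
  W u n (λ A → 4 * n * sum (λ i → 𝟙 (h i A))) ∎)
  where
  open ≤-Reasoning
  ℓ = sum (𝟙 ∘ L)
  P = suc u ^ n
  lem₁ : ∀ P ℓ n → P * (ℓ * n) + ℓ * (n * P) ≡ 2 * n * (P * ℓ)
  lem₁ = solve-∀
  lem₂ : ∀ n x → 2 * n * (2 * x) ≡ 4 * n * x
  lem₂ = solve-∀

-- Random cuts of a functional graph.

-- Membership is put as inclusion of a singleton so that `W-hit` and `W-miss` apply to it.
mem : ∀ {n} → Fin n → Subset n → Bool
mem i X = does (⁅ i ⁆ ⊆? X)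

mem-∪ : ∀ {n} {i j : Fin n} → i ≢ j → ∀ X → mem i X ≡ mem i (X ∪ ⁅ j ⁆)
mem-∪ {i = i} {j} i≢j X = ⊆?-∪-disjoint ⁅ j ⁆ ⁅ i ⁆ X λ (x , x∈) →
  let x∈j , x∈i = x∈p∩q⁻ ⁅ j ⁆ ⁅ i ⁆ x∈
  in i≢j (trans (sym (x∈⁅y⁆⇒x≡y i x∈i)) (x∈⁅y⁆⇒x≡y j x∈j))

not-true : ∀ {a} → not a ≡ true → a ≡ false
not-true {false} _ = refl

∧-not-intro : ∀ {a b} → a ≡ true → b ≡ false → a ∧ not b ≡ true
∧-not-intro refl refl = refl

∧-elim : ∀ a {b} → a ∧ b ≡ true → a ≡ true × b ≡ true
∧-elim true eq = refl , eq

-- With density 1/2 the events at two distinct points are independent, so an arrow crosses the cut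
-- in the given direction with probability 1/4.
W-cut : ∀ {n} {i j : Fin n} → i ≢ j →
  4 * W 1 n (λ X → 𝟙 (mem i X ∧ not (mem j X))) ≡ 2 ^ n
W-cut {n} {i} {j} i≢j = begin
  4 * W 1 n (λ X → 𝟙 (mem i X ∧ not (mem j X)))
    ≡⟨ cong (4 *_) (W-cong 1 n (λ X → trans (𝟙-∧ (mem i X) (not (mem j X))) (*-comm (𝟙 (mem i X)) _))) ⟩
  4 * w                ≡⟨ lem w ⟩
  w * 2 * 2            ≡⟨ cong (_* 2) (trans (W-miss 1 ⁅ j ⁆ (𝟙 ∘ mem i) (cong 𝟙 ∘ mem-∪ i≢j) 1 (cong (2 ^_) (∣⁅x⁆∣≡1 j)))
                          (+-identityʳ _)) ⟩
  W 1 n (𝟙 ∘ mem i) * 2 ≡⟨ cong₂ _*_ (W-cong 1 n (λ X → sym (*-identityʳ _))) (cong (2 ^_) (sym (∣⁅x⁆∣≡1 i))) ⟩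
  W 1 n (λ X → 𝟙 (mem i X) * 1) * 2 ^ ∣ ⁅ i ⁆ ∣ ≡⟨ W-hit 1 ⁅ i ⁆ (λ _ → 1) (λ _ → refl) ⟩
  W 1 n (λ _ → 1)      ≡⟨ W-const 1 n 1 ⟩
  2 ^ n * 1            ≡⟨ *-identityʳ _ ⟩
  2 ^ n ∎
  where
  open ≡-Reasoning
  w = W 1 n (λ X → 𝟙 (not (mem j X)) * 𝟙 (mem i X))
  lem : ∀ w → 4 * w ≡ w * 2 * 2
  lem = solve-∀

cut : ∀ {n} (H : Fin n → Bool) (g : Fin n → Fin n) → (∀ i → H i ≡ true → i ≢ g i) →
  ∃ λ X → sum (𝟙 ∘ H) ≤ 4 * sum (λ i → 𝟙 (H i ∧ mem i X ∧ not (mem (g i) X)))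
cut {n} H g i≢gi = W-witness 1 n (begin
  W 1 n (λ _ → sum (𝟙 ∘ H))               ≡⟨ W-const 1 n _ ⟩
  2 ^ n * sum (𝟙 ∘ H)                      ≡⟨ *-distribˡ-sum (2 ^ n) (𝟙 ∘ H) ⟩
  sum (λ i → 2 ^ n * 𝟙 (H i))              ≤⟨ sum-mono-≤ pointwise ⟩
  sum (λ i → 4 * W 1 n (λ X → c i X))      ≡⟨ *-distribˡ-sum 4 (λ i → W 1 n (c i)) ⟨
  4 * sum (λ i → W 1 n (c i))              ≡⟨ cong (4 *_) (W-sum 1 n n c) ⟨
  4 * W 1 n (λ X → sum (λ i → c i X))      ≡⟨ W-* 1 n 4 _ ⟨
  W 1 n (λ X → 4 * sum (λ i → c i X))      ∎)
  where
  open ≤-Reasoning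
  c : Fin n → Subset n → ℕ
  c i X = 𝟙 (H i ∧ mem i X ∧ not (mem (g i) X))
  pointwise : ∀ i → 2 ^ n * 𝟙 (H i) ≤ 4 * W 1 n (c i)
  pointwise i with H i | i≢gi i
  ... | false | _ = ≤-trans (≤-reflexive (*-zeroʳ (2 ^ n))) z≤n
  ... | true  | h = ≤-reflexive (trans (*-identityʳ _) (sym (W-cut (h refl))))

-- `R` collects the sources of the arrows leaving the cut `X`. Their targets lie outside `X`, hence
-- outside `R`, so all of `R` can be redirected at once.
independent-part : ∀ {n} (H : Fin n → Bool) (g : Fin n → Fin n) → (∀ i → H i ≡ true → i ≢ g i) →
  ∃ λ R → (∀ i → R i ≡ true → H i ≡ true × R (g i) ≡ false) × sum (𝟙 ∘ H) ≤ 4 * sum (𝟙 ∘ R)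
independent-part H g i≢gi = let X , large = cut H g i≢gi in
  (λ i → H i ∧ mem i X ∧ not (mem (g i) X)) ,
  (λ i eq → let hi , eq′ = ∧-elim (H i) eq ; _ , gi∉X = ∧-elim (mem i X) eq′ in
     hi , trans (cong (λ b → H (g i) ∧ b ∧ not (mem (g (g i)) X)) (not-true gi∉X)) (∧-zeroʳ (H (g i)))) ,
  large

-- Sizes and their decay over the rounds.

𝟙-mono : ∀ {a b} → (a ≡ true → b ≡ true) → 𝟙 a ≤ 𝟙 b
𝟙-mono {false} _ = z≤n
𝟙-mono {true}  h rewrite h refl = ≤-refl

sum-remove-part : ∀ {n} (K R : Fin n → Bool) → (∀ i → R i ≡ true → K i ≡ true) →
  sum (λ i → 𝟙 (K i ∧ not (R i))) + sum (𝟙 ∘ R) ≡ sum (𝟙 ∘ K)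
sum-remove-part K R R⊆K =
  trans (sym (∑-distrib-+ (λ i → 𝟙 (K i ∧ not (R i))) (𝟙 ∘ R))) (sum-cong-≗ pointwise)
  where
  pointwise : ∀ i → 𝟙 (K i ∧ not (R i)) + 𝟙 (R i) ≡ 𝟙 (K i)
  pointwise i with K i | R i | R⊆K i
  ... | true  | true  | _ = refl
  ... | true  | false | _ = refl
  ... | false | false | _ = refl
  ... | false | true  | h = contradiction (h refl) λ ()

-- Chaining the three losses gives r ≥ x/32, with 32 = 2 · 4 · 4: half of the core is light, a
-- quarter of that is hit, a quarter of the hits is removed.
loses-share : ∀ {x x′ ℓ h r} → x′ + r ≡ x → x ≤ 2 * ℓ → ℓ ≤ 4 * h → h ≤ 4 * r → 32 * x′ ≤ 31 * x
loses-share {x} {x′} {ℓ} {h} {r} split x≤ ℓ≤ h≤ = +-cancelʳ-≤ x _ _ (begin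
  32 * x′ + x                  ≤⟨ +-monoʳ-≤ (32 * x′) (≤-trans x≤ (*-monoʳ-≤ 2 (≤-trans ℓ≤ (*-monoʳ-≤ 4 h≤)))) ⟩
  32 * x′ + 2 * (4 * (4 * r))  ≡⟨ lem₁ x′ r ⟩
  32 * (x′ + r)                ≡⟨ cong (32 *_) split ⟩
  32 * x                       ≡⟨ +-comm x (31 * x) ⟩
  31 * x + x                   ∎)
  where
  open ≤-Reasoning
  lem₁ : ∀ a b → 32 * a + 2 * (4 * (4 * b)) ≡ 32 * (a + b)
  lem₁ = solve-∀

shrinks : ∀ m {x y z} → 32 * y ≤ 31 * x → 32 ^ m * z ≤ 31 ^ m * y → 32 ^ suc m * z ≤ 31 ^ suc m * x
shrinks m {x} {y} {z} h₁ h₂ = begin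
  32 * 32 ^ m * z     ≡⟨ *-assoc 32 (32 ^ m) z ⟩
  32 * (32 ^ m * z)   ≤⟨ *-monoʳ-≤ 32 h₂ ⟩
  32 * (31 ^ m * y)   ≡⟨ *-assoc 32 (31 ^ m) y ⟨
  32 * 31 ^ m * y     ≡⟨ cong (_* y) (*-comm 32 (31 ^ m)) ⟩
  31 ^ m * 32 * y     ≡⟨ *-assoc (31 ^ m) 32 y ⟩
  31 ^ m * (32 * y)   ≤⟨ *-monoʳ-≤ (31 ^ m) h₁ ⟩
  31 ^ m * (31 * x)   ≡⟨ *-assoc (31 ^ m) 31 x ⟨
  31 ^ m * 31 * x     ≡⟨ cong (_* x) (*-comm (31 ^ m) 31) ⟩
  31 * 31 ^ m * x     ∎
  where open ≤-Reasoning

^-distribʳ-* : ∀ k a b → (a * b) ^ k ≡ a ^ k * b ^ k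
^-distribʳ-* zero    a b = refl
^-distribʳ-* (suc k) a b = trans (cong (a * b *_) (^-distribʳ-* k a b)) (lem a b (a ^ k) (b ^ k))
  where
  lem : ∀ a b p q → a * b * (p * q) ≡ a * p * (b * q)
  lem = solve-∀

-- 22 rounds halve the core, because 2 · 31²² ≤ 32²².
vanishes : ∀ l {x n} → 32 ^ (22 * suc l) * x ≤ 31 ^ (22 * suc l) * n → n < 2 ^ suc l → x ≡ 0
vanishes l {zero}  _ _ = refl
vanishes l {suc x} {n} h n< = contradiction (begin-strict
  31 ^ (22 * suc l) * n              <⟨ *-monoʳ-< (31 ^ (22 * suc l)) {{m^n≢0 31 (22 * suc l)}} n< ⟩
  31 ^ (22 * suc l) * 2 ^ suc l      ≡⟨ cong (_* 2 ^ suc l) (^-*-assoc 31 22 (suc l)) ⟨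
  (31 ^ 22) ^ suc l * 2 ^ suc l      ≡⟨ ^-distribʳ-* (suc l) (31 ^ 22) 2 ⟨
  (31 ^ 22 * 2) ^ suc l              ≤⟨ ^-monoˡ-≤ (suc l) (≤ᵇ⇒≤ (31 ^ 22 * 2) (32 ^ 22) _) ⟩
  (32 ^ 22) ^ suc l                  ≡⟨ ^-*-assoc 32 22 (suc l) ⟩
  32 ^ (22 * suc l)                  ≤⟨ m≤m*n _ (suc x) ⟩
  32 ^ (22 * suc l) * suc x          ≤⟨ h ⟩
  31 ^ (22 * suc l) * n              ∎) (n≮n _)
  where open ≤-Reasoning

∣p∪q∣≤∣p∣+∣q∣ : ∀ {n} (p q : Subset n) → ∣ p ∪ q ∣ ≤ ∣ p ∣ + ∣ q ∣
∣p∪q∣≤∣p∣+∣q∣ []          []          = z≤n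
∣p∪q∣≤∣p∣+∣q∣ (false ∷ p) (false ∷ q) = ∣p∪q∣≤∣p∣+∣q∣ p q
∣p∪q∣≤∣p∣+∣q∣ (false ∷ p) (true ∷ q)  =
  ≤-trans (s≤s (∣p∪q∣≤∣p∣+∣q∣ p q)) (≤-reflexive (sym (+-suc ∣ p ∣ ∣ q ∣)))
∣p∪q∣≤∣p∣+∣q∣ (true ∷ p)  (false ∷ q) = s≤s (∣p∪q∣≤∣p∣+∣q∣ p q)
∣p∪q∣≤∣p∣+∣q∣ (true ∷ p)  (true ∷ q)  =
  s≤s (≤-trans (∣p∪q∣≤∣p∣+∣q∣ p q) (+-monoʳ-≤ ∣ p ∣ (n≤1+n ∣ q ∣)))

someIn⁻ : ∀ {n} (G : List (Subset n)) {A} → someIn G A ≡ true → Any (_⊆ A) G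
someIn⁻ G {A} eq with any? (_⊆? A) G
... | yes p = p

-- The rounds that shrink the core.

module Iteration {n} (𝒮 : Spanoid n) (k u : ℕ)
  (lcs : ∀ i → Σ (List (Subset n)) λ M → All (λ S → ∣ S ∣ ≡ suc k) M × AllPairs Disjoint M
         × All (λ S → 𝒮 S i) M × 2 * suc u ^ k ≤ length M) where

  -- 1/N is the probability that the random set contains a given k-set, and `N` is also the
  -- threshold for a light fibre. Of the 2N rules at least N survive puncturing by such a fibre.
  N = suc u ^ k

  record State : Set where
    field
      A   : Subset n
      K   : Fin n → Bool
      f   : Fin n → Fin n
      f∈K : ∀ s → K (f s) ≡ true
      der : ∀ s → Derives 𝒮 (λ x → x ∈ A ⊎ x ≡ f s) s

  open State

  ∥_∥ : State → ℕ
  ∥ st ∥ = sum (𝟙 ∘ K st)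

  module Round (st : State) (big : 2 * n ≤ ∥ st ∥ * N) (n>0 : 0 < n) where

    fiber : Fin n → Subset n
    fiber i = tabulate (λ s → does (f st s Fin.≟ i))

    light : Fin n → Bool
    light i = K st i ∧ (∣ fiber i ∣ <ᵇ N)

    ℓ = sum (𝟙 ∘ light)

    -- A core point that is not light has at least `N` points in its fibre, and the fibres have n
    -- points in total. So at most n/N core points are heavy, which `big` bounds by half of the
    -- core.
    half-light : ∥ st ∥ ≤ 2 * ℓ
    half-light = *-cancelʳ-≤ _ _ N {{m^n≢0 (suc u) k}} (+-cancelʳ-≤ (∥ st ∥ * N) _ _ (begin
      ∥ st ∥ * N + ∥ st ∥ * N      ≡⟨ lem₁ ∥ st ∥ N ⟩
      2 * (N * ∥ st ∥)             ≡⟨ cong (2 *_) (*-distribˡ-sum N (𝟙 ∘ K st)) ⟩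
      2 * sum (λ i → N * 𝟙 (K st i)) ≤⟨ *-monoʳ-≤ 2 (sum-mono-≤ pointwise) ⟩
      2 * sum (λ i → N * 𝟙 (light i) + ∣ fiber i ∣)
        ≡⟨ cong (2 *_) (trans (∑-distrib-+ (λ i → N * 𝟙 (light i)) (λ i → ∣ fiber i ∣))
             (cong₂ _+_ (sym (*-distribˡ-sum N (𝟙 ∘ light)))
               (trans (sum-cong-≗ (λ i → ∣tabulate∣ (λ s → does (f st s Fin.≟ i)))) (sum-fibers (f st))))) ⟩
      2 * (N * ℓ + n)              ≡⟨ lem₂ N ℓ n ⟩
      2 * ℓ * N + 2 * n            ≤⟨ +-monoʳ-≤ (2 * ℓ * N) big ⟩
      2 * ℓ * N + ∥ st ∥ * N       ∎))
      where
      open ≤-Reasoning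
      lem₁ : ∀ a N → a * N + a * N ≡ 2 * (N * a)
      lem₁ = solve-∀
      lem₂ : ∀ N ℓ n → 2 * (N * ℓ + n) ≡ 2 * ℓ * N + 2 * n
      lem₂ = solve-∀
      pointwise : ∀ i → N * 𝟙 (K st i) ≤ N * 𝟙 (light i) + ∣ fiber i ∣
      pointwise i with K st i | ∣ fiber i ∣ <ᵇ N in eq
      ... | false | _     = ≤-trans (≤-reflexive (*-zeroʳ N)) z≤n
      ... | true  | true  = m≤m+n _ _
      ... | true  | false = ≤-trans (≤-reflexive (*-identityʳ N)) (≤-trans (≮⇒≥ (subst T eq ∘ <⇒<ᵇ)) (m≤n+m _ _))

    -- `S′` stands for a rule set with one point `s` deleted. Lightness is recorded here so that
    -- every hit can be traced back to a light point.
    Pointed : Fin n → Subset n → Set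
    Pointed i S′ = light i ≡ true × ∃ λ s → f st s ≢ i ×
      ∃ λ S → 𝒮 S i × (∀ x → x ∈ S → x ∈ S′ ⊎ x ≡ s)

    Family : Fin n → Set
    Family i = ∃ λ G → All (Pointed i) G × suc u ^ n * 𝟙 (light i) ≤ 2 * W u n (𝟙 ∘ someIn G)

    -- A point that is not light receives the empty family and is never hit. For a light one,
    -- puncturing by its own fibre costs fewer than `N` rules.
    family′ : ∀ i b → light i ≡ b →
      ∃ λ G → All (Pointed i) G × suc u ^ n * 𝟙 b ≤ 2 * W u n (𝟙 ∘ someIn G)
    family′ i false _  = [] , [] , ≤-trans (≤-reflexive (*-zeroʳ (suc u ^ n))) z≤n
    family′ i true  eq =
      let M , cs , ds , rs , len = lcs i
          G , ds′ , cs′ , ps , _ , len′ = puncture (λ S → 𝒮 S i) M (fiber i) ds cs rs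
      in G , All.map (λ (s , s∉ , S , r , _ , split) →
                  eq , s , (λ fs≡i → s∉ (∈-tabulate⁺ _ (dec-true (f st s Fin.≟ i) fs≡i))) , S , r , split) ps
           , ≤-trans (≤-reflexive (*-identityʳ _))
               (W-someIn u k G ds′ cs′ (+-cancelʳ-≤ N N (length G) (begin
                 N + N                     ≡⟨ cong (N +_) (+-identityʳ N) ⟨
                 2 * N                     ≤⟨ len ⟩
                 length M                  ≤⟨ len′ ⟩
                 length G + ∣ fiber i ∣    ≤⟨ +-monoʳ-≤ (length G) (<⇒≤ small) ⟩
                 length G + N              ∎)))
      where
      open ≤-Reasoning
      small : ∣ fiber i ∣ < N
      small = <ᵇ⇒< _ _ (subst T (sym (proj₂ (∧-elim (K st i) eq))) _)

    abstract
      family : ∀ i → Family i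
      family i = family′ i (light i) refl

    G : Fin n → List (Subset n)
    G i = proj₁ (family i)

    abstract
      sampled : ∃ λ A → ℓ * n + ℓ * (suc u * ∣ A ∣) ≤ 4 * n * sum (λ i → 𝟙 (someIn (G i) A))
      sampled = sample u light (λ i → someIn (G i)) (λ i → proj₂ (proj₂ (family i)))

    A′ : Subset n
    A′ = proj₁ sampled

    hit : Fin n → Bool
    hit i = someIn (G i) A′

    widen : ∀ {i j} → Derives 𝒮 (λ x → x ∈ A st ⊎ x ≡ j) i → Derives 𝒮 (λ x → x ∈ A st ∪ A′ ⊎ x ≡ j) i
    widen = Derives-bind (λ _ → [ (λ x∈A → base (inj₁ (x∈p∪q⁺ (inj₁ x∈A)))) , base ∘ inj₂ ]′)

    Out : Fin n → Fin n → Set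
    Out i j = light i ≡ true × i ≢ j × K st j ≡ true × Derives 𝒮 (λ x → x ∈ A st ∪ A′ ⊎ x ≡ j) i

    -- The arrow leads to `f st s` for the deleted point `s`: the other premises lie in `A′`, and
    -- `s` follows from `A st` and `f st s`. Having chosen `s` outside the fibre of `i` excludes a
    -- loop.
    out-hit : ∀ i → hit i ≡ true → ∃ (Out i)
    out-hit i eq =
      let (li , s , fs≢i , S , r , split) , S′⊆A′ =
            All.lookupAny (proj₁ (proj₂ (family i))) (someIn⁻ (G i) eq)
      in f st s , li , fs≢i ∘ sym , f∈K st s , rule S r (λ x x∈S →
        [ (λ x∈S′ → base (inj₁ (x∈p∪q⁺ (inj₂ (S′⊆A′ x∈S′)))))
        , (λ { refl → widen (der st s) })
        ]′ (split x x∈S))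

    abstract
      out : ∀ i → ∃ λ j → hit i ≡ true → Out i j
      out i = case (hit i Bool.≟ true) of λ where
        (yes h) → let j , o = out-hit i h in j , λ _ → o
        -- A dummy target: the implication is vacuous for a point that is not hit.
        (no ¬h) → i , λ h → contradiction h ¬h

    g : Fin n → Fin n
    g i = proj₁ (out i)

    abstract
      removal : ∃ λ R → (∀ i → R i ≡ true → hit i ≡ true × R (g i) ≡ false)
        × sum (𝟙 ∘ hit) ≤ 4 * sum (𝟙 ∘ R)
      removal = independent-part hit g (λ i hi → proj₁ (proj₂ (proj₂ (out i) hi)))

    R : Fin n → Bool
    R = proj₁ removal

    R-out : ∀ i → R i ≡ true → Out i (g i)
    R-out i r = proj₂ (out i) (proj₁ (proj₁ (proj₂ removal) i r))

    move : ∀ s → ∃ λ j →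
      K st j ∧ not (R j) ≡ true × Derives 𝒮 (λ x → x ∈ A st ∪ A′ ⊎ x ≡ j) s
    move s = case (R (f st s) Bool.≟ true) of λ where
      -- The old target is removed, so its arrow is followed. One arrow is enough, since arrows from
      -- `R` end outside `R`.
      (yes r) → let _ , _ , kj , d = R-out (f st s) r in
        g (f st s) , ∧-not-intro kj (proj₂ (proj₁ (proj₂ removal) (f st s) r)) ,
        Derives-bind (λ _ → [ base ∘ inj₁ ∘ x∈p∪q⁺ ∘ inj₁ , (λ { refl → d }) ]′) (der st s)
      (no ¬r) → f st s , ∧-not-intro (f∈K st s) (¬-not ¬r) , widen (der st s)

    next : State
    A next = A st ∪ A′
    K next i = K st i ∧ not (R i)
    f next s = proj₁ (move s)
    f∈K next s = proj₁ (proj₂ (move s))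
    der next s = proj₂ (proj₂ (move s))

    hits = sum (𝟙 ∘ hit)
    t = suc u

    -- First use of the sampled inequality: the term with the size of `A′` is dropped.
    ℓ≤4hits : ℓ ≤ 4 * hits
    ℓ≤4hits = *-cancelʳ-≤ _ _ n {{>-nonZero n>0}} (begin
      ℓ * n                          ≤⟨ m≤m+n _ _ ⟩
      ℓ * n + ℓ * (t * ∣ A′ ∣)       ≤⟨ proj₂ sampled ⟩
      4 * n * hits                   ≡⟨ lem n hits ⟩
      4 * hits * n                   ∎)
      where
      open ≤-Reasoning
      lem : ∀ n h → 4 * n * h ≡ 4 * h * n
      lem = solve-∀

    hits≤ℓ : hits ≤ ℓ
    hits≤ℓ = sum-mono-≤ (λ i → 𝟙-mono (λ hi → proj₁ (proj₂ (out i) hi)))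

    -- Without light points `half-light` would empty the core, against `big`.
    ℓ>0 : 0 < ℓ
    ℓ>0 with ℓ in eq
    ... | suc _ = z<s
    ... | zero  = contradiction big (<⇒≱ (subst (λ x → x * N < 2 * n)
                    (sym (n≤0⇒n≡0 (subst (λ x → ∥ st ∥ ≤ 2 * x) eq half-light))) (≤-trans n>0 (m≤n*m n 2))))

    -- Second use: as only light points are hit, the right side is at most 4nℓ, and cancelling ℓn
    -- leaves 3nℓ.
    size-A′ : t * ∣ A′ ∣ ≤ 3 * n
    size-A′ = *-cancelˡ-≤ ℓ {{>-nonZero ℓ>0}} (+-cancelˡ-≤ (ℓ * n) _ _ (begin
      ℓ * n + ℓ * (t * ∣ A′ ∣)    ≤⟨ proj₂ sampled ⟩
      4 * n * hits                ≤⟨ *-monoʳ-≤ (4 * n) hits≤ℓ ⟩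
      4 * n * ℓ                   ≡⟨ lem n ℓ ⟩
      ℓ * n + ℓ * (3 * n)         ∎))
      where
      open ≤-Reasoning
      lem : ∀ n l → 4 * n * l ≡ l * n + l * (3 * n)
      lem = solve-∀

    shrink : 32 * ∥ next ∥ ≤ 31 * ∥ st ∥
    shrink = loses-share {∥ st ∥} {∥ next ∥} {ℓ} {hits} {sum (𝟙 ∘ R)} (sum-remove-part (K st) R (λ i r → proj₁ (∧-elim (K st i) (proj₁ (R-out i r)))))
      half-light ℓ≤4hits (proj₂ (proj₂ removal))

  initial : State
  initial = record { A = ⊥ ; K = λ _ → true ; f = id ; f∈K = λ _ → refl ; der = λ _ → base (inj₂ refl) }

  -- The loop either stops early at a small core or shrinks the core in all `m` rounds; each round
  -- run adds at most 3n to the weighted size of `A`.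
  iterate : 0 < n → ∀ m st → ∃ λ st′ → suc u * ∣ A st′ ∣ ≤ suc u * ∣ A st ∣ + m * (3 * n)
    × (∥ st′ ∥ * N < 2 * n ⊎ 32 ^ m * ∥ st′ ∥ ≤ 31 ^ m * ∥ st ∥)
  iterate n>0 zero    st = st , m≤m+n _ _ , inj₂ ≤-refl
  iterate n>0 (suc m) st = case (2 * n ≤? ∥ st ∥ * N) of λ where
    (no ¬big) → st , m≤m+n _ _ , inj₁ (≰⇒> ¬big)
    (yes big) → let open Round st big n>0 ; st′ , sA , done = iterate n>0 m next in
      st′ ,
      ≤-trans sA (≤-trans (+-monoˡ-≤ (m * (3 * n))
        (≤-trans (*-monoʳ-≤ (suc u) (∣p∪q∣≤∣p∣+∣q∣ (A st) A′))
          (≤-trans (≤-reflexive (*-distribˡ-+ (suc u) ∣ A st ∣ ∣ A′ ∣)) (+-monoʳ-≤ (suc u * ∣ A st ∣) size-A′))))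
        (≤-reflexive (+-assoc (suc u * ∣ A st ∣) (3 * n) (m * (3 * n))))) ,
      map₂ (shrinks m shrink) done

  -- 134 n l bounds the 22 (l + 1) · 3n of the rounds plus the 2n of the final core.
  small-spanning : 1 ≤ k → 0 < n → ∀ l → 1 ≤ l → n < 2 ^ suc l →
    ∃ λ T → Spanning 𝒮 T × suc u * ∣ T ∣ ≤ 134 * (n * l)
  small-spanning k≥1 n>0 l l≥1 n< =
    A st ∪ tabulate (K st) ,
    (λ i → Derives⇒⊨ (Derives-bind
      (λ _ → [ base ∘ x∈p∪q⁺ ∘ inj₁ , (λ { refl → base (x∈p∪q⁺ (inj₂ (∈-tabulate⁺ (K st) (f∈K st i)))) }) ]′)
      (der st i))) ,
    (begin
      t * ∣ A st ∪ tabulate (K st) ∣            ≤⟨ *-monoʳ-≤ t (∣p∪q∣≤∣p∣+∣q∣ (A st) _) ⟩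
      t * (∣ A st ∣ + ∣ tabulate (K st) ∣)      ≡⟨ cong (λ x → t * (∣ A st ∣ + x)) (∣tabulate∣ (K st)) ⟩
      t * (∣ A st ∣ + ∥ st ∥)                   ≡⟨ *-distribˡ-+ t ∣ A st ∣ ∥ st ∥ ⟩
      t * ∣ A st ∣ + t * ∥ st ∥                 ≤⟨ +-mono-≤ (proj₁ (proj₂ run)) (*-monoˡ-≤ ∥ st ∥ t≤N) ⟩
      t * ∣ ⊥ {n} ∣ + m * (3 * n) + N * ∥ st ∥  ≤⟨ +-mono-≤ (≤-reflexive (cong (_+ m * (3 * n)) (trans (cong (t *_) (∣⊥∣≡0 n)) (*-zeroʳ t))))
                                                     (≤-trans (≤-reflexive (*-comm N ∥ st ∥)) (<⇒≤ few)) ⟩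
      m * (3 * n) + 2 * n                       ≡⟨ lem₁ l n ⟩
      66 * (n * l) + 68 * (n * 1)               ≤⟨ +-monoʳ-≤ (66 * (n * l)) (*-monoʳ-≤ 68 (*-monoʳ-≤ n l≥1)) ⟩
      66 * (n * l) + 68 * (n * l)               ≡⟨ *-distribʳ-+ (n * l) 66 68 ⟨
      134 * (n * l)                             ∎)
    where
    open ≤-Reasoning
    t = suc u
    m = 22 * suc l
    run = iterate n>0 m initial
    st  = proj₁ run
    -- Lets the final core be charged as N · ∥ st ∥, which `few` bounds by 2n.
    t≤N : t ≤ N
    t≤N = subst (_≤ N) (^-identityʳ t) (^-monoʳ-≤ t k≥1)
    lem₁ : ∀ l n → 22 * suc l * (3 * n) + 2 * n ≡ 66 * (n * l) + 68 * (n * 1)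
    lem₁ = solve-∀
    -- If no round stopped early, `vanishes` makes the core empty.
    few : ∥ st ∥ * N < 2 * n
    few = [ id , (λ h → subst (λ x → x * N < 2 * n)
      (sym (vanishes l (subst (λ x → 32 ^ m * ∥ st ∥ ≤ 31 ^ m * x) (trans (sum-const n 1) (*-identityʳ n)) h) n<))
      (≤-trans n>0 (m≤n*m n 2))) ]′ (proj₂ (proj₂ run))

-- From the iteration to a bound on the rank.

-- A descending search from `b` stops where `g` crosses `d`. It supplies both an integer root and an
-- integer logarithm.
bracket : (g : ℕ → ℕ) → ∀ {d} → g 0 ≤ d → ∀ b → d < g b → ∃ λ t → g t ≤ d × d < g (suc t)
bracket g g0≤ zero    d< = contradiction d< (≤⇒≯ g0≤)
bracket g {d} g0≤ (suc b) d< = case (g b ≤? d) of λ where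
  (yes gb≤) → b , gb≤ , d<
  (no ¬gb≤) → bracket g g0≤ b (≰⇒> ¬gb≤)

argmin : ∀ {n} (f : Fin (suc n) → ℕ) → ∃ λ i → ∀ j → f i ≤ f j
argmin {zero}  f = zero , λ { zero → ≤-refl }
argmin {suc n} f = let i , min = argmin (f ∘ suc) in case (f zero ≤? f (suc i)) of λ where
  (yes p) → zero , λ { zero → ≤-refl ; (suc j) → ≤-trans p (min j) }
  (no ¬p) → suc i , λ { zero → <⇒≤ (≰⇒> ¬p) ; (suc j) → min j }

-- With K the exponent, choose t so that 2t^K ≤ d < 2(t+1)^K. For t ≥ 1 this gives d ≤ (4t)^K, and
-- the rounds give t · r ≤ 134nl; multiplying yields 536 = 4 · 134.
rank-bound : ∀ {n} (𝒮 : Spanoid n) k d l r → 1 ≤ k → 0 < n → 1 ≤ l → n < 2 ^ suc l →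
  (∀ i → Σ (List (Subset n)) λ M → All (λ S → ∣ S ∣ ≡ suc k) M × AllPairs Disjoint M
         × All (λ S → 𝒮 S i) M × d ≤ length M) →
  IsRank 𝒮 r → r ^ k * d ≤ (536 * n * l) ^ k
rank-bound {n} 𝒮 (suc k) d l r k≥1 n>0 l≥1 n< lcs ((T , _ , ∣T∣≡r) , minimal)
  with bracket (λ t → 2 * t ^ suc k) {d} z≤n (suc d) (≤-trans (m≤m*n (suc d) (suc d ^ k) {{m^n≢0 (suc d) k}}) (m≤n*m (suc d ^ suc k) 2))
-- Here d ≤ 1, and the trivial bound r ≤ n is enough.
... | zero , _ , d<2 = begin
  r ^ suc k * d              ≤⟨ *-mono-≤ (^-monoˡ-≤ (suc k) (≤-trans (≤-reflexive (sym ∣T∣≡r)) (∣p∣≤n T)))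
                                  (≤-pred (≤-trans d<2 (≤-reflexive (cong (2 *_) (^-zeroˡ (suc k)))))) ⟩
  n ^ suc k * 1              ≡⟨ *-identityʳ _ ⟩
  n ^ suc k                  ≤⟨ ^-monoˡ-≤ (suc k) (≤-trans (m≤n*m n 536) (m≤m*n (536 * n) l {{>-nonZero l≥1}})) ⟩
  (536 * n * l) ^ suc k      ∎
  where open ≤-Reasoning
... | suc u , 2t^k≤d , d< = begin
  r ^ suc k * d              ≤⟨ *-monoʳ-≤ (r ^ suc k) d≤ ⟩
  r ^ suc k * (4 * t) ^ suc k ≡⟨ ^-distribʳ-* (suc k) r (4 * t) ⟨
  (r * (4 * t)) ^ suc k      ≤⟨ ^-monoˡ-≤ (suc k) (begin
    r * (4 * t)                ≡⟨ lem₁ r t ⟩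
    4 * (t * r)                ≤⟨ *-monoʳ-≤ 4 (≤-trans (*-monoʳ-≤ t (minimal (proj₁ small) (proj₁ (proj₂ small)))) (proj₂ (proj₂ small))) ⟩
    4 * (134 * (n * l))        ≡⟨ lem₂ n l ⟩
    536 * n * l                ∎) ⟩
  (536 * n * l) ^ suc k      ∎
  where
  open ≤-Reasoning
  t = suc u
  lcs′ : ∀ i → Σ (List (Subset n)) λ M → All (λ S → ∣ S ∣ ≡ suc (suc k)) M × AllPairs Disjoint M
         × All (λ S → 𝒮 S i) M × 2 * suc u ^ suc k ≤ length M
  lcs′ i = let M , cs , ds , rs , len = lcs i in M , cs , ds , rs , ≤-trans 2t^k≤d len
  small = Iteration.small-spanning 𝒮 (suc k) u lcs′ k≥1 n>0 l l≥1 n<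
  lem₁ : ∀ r t → r * (4 * t) ≡ 4 * (t * r)
  lem₁ = solve-∀
  lem₂ : ∀ n l → 4 * (134 * (n * l)) ≡ 536 * n * l
  lem₂ n l = trans (sym (*-assoc 4 134 (n * l))) (sym (*-assoc 536 n l))
  lem₃ : ∀ u → 2 * suc (suc u) + 2 * u ≡ 4 * suc u
  lem₃ = solve-∀
  d≤ : d ≤ (4 * t) ^ suc k
  d≤ = begin
    d                          ≤⟨ <⇒≤ d< ⟩
    2 * suc t ^ suc k          ≤⟨ *-monoˡ-≤ (suc t ^ suc k) (m≤m*n 2 (2 ^ k) {{m^n≢0 2 k}}) ⟩
    2 ^ suc k * suc t ^ suc k  ≡⟨ ^-distribʳ-* (suc k) 2 (suc t) ⟨
    (2 * suc t) ^ suc k        ≤⟨ ^-monoˡ-≤ (suc k) (≤-trans (m≤m+n _ (2 * u)) (≤-reflexive (lem₃ u))) ⟩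
    (4 * t) ^ suc k            ∎

-- Clearing rationals and logarithms.

toℚᵘ-ℕ→ℚ : ∀ m → ℚ.toℚᵘ (ℕ→ℚ m) ℚᵘ.≃ ℚᵘ.mkℚᵘ (ℤ.+ m) 0
toℚᵘ-ℕ→ℚ m = ℚ.toℚᵘ-fromℚᵘ (ℚᵘ.mkℚᵘ (ℤ.+ m) 0)

ℕ→ℚ-* : ∀ a b → ℕ→ℚ (a * b) ≡ ℕ→ℚ a ℚ.* ℕ→ℚ b
ℕ→ℚ-* a b = ℚ.toℚᵘ-injective (begin
  ℚ.toℚᵘ (ℕ→ℚ (a * b))                       ≈⟨ toℚᵘ-ℕ→ℚ (a * b) ⟩
  ℚᵘ.mkℚᵘ (ℤ.+ (a * b)) 0                    ≡⟨ cong (λ x → ℚᵘ.mkℚᵘ x 0) (ℤ.pos-* a b) ⟩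
  ℚᵘ.mkℚᵘ (ℤ.+ a) 0 ℚᵘ.* ℚᵘ.mkℚᵘ (ℤ.+ b) 0   ≈⟨ ℚᵘ.*-cong (toℚᵘ-ℕ→ℚ a) (toℚᵘ-ℕ→ℚ b) ⟨
  ℚ.toℚᵘ (ℕ→ℚ a) ℚᵘ.* ℚ.toℚᵘ (ℕ→ℚ b)         ≈⟨ ℚ.toℚᵘ-homo-* (ℕ→ℚ a) (ℕ→ℚ b) ⟨
  ℚ.toℚᵘ (ℕ→ℚ a ℚ.* ℕ→ℚ b)                   ∎)
  where open ℚᵘ.≃-Reasoning

ℕ→ℚ-cancel-< : ∀ {a b} → ℕ→ℚ a ℚ.< ℕ→ℚ b → a < b
ℕ→ℚ-cancel-< {a} {b} h = ℤ.drop‿+<+ (subst₂ ℤ._<_ (ℤ.*-identityʳ _) (ℤ.*-identityʳ _)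
  (ℚᵘ.drop-*<* (ℚᵘ.<-respˡ-≃ (toℚᵘ-ℕ→ℚ a) (ℚᵘ.<-respʳ-≃ (toℚᵘ-ℕ→ℚ b) (ℚ.toℚᵘ-mono-< h)))))

ℕ→ℚ-nonNeg : ∀ m → ℚ.NonNegative (ℕ→ℚ m)
ℕ→ℚ-nonNeg m = ℚ.normalize-nonNeg m 1

ℕ→ℚ-pos : ∀ {m} → 0 < m → ℚ.Positive (ℕ→ℚ m)
ℕ→ℚ-pos {m} m>0 = ℚ.normalize-pos m 1 {{_}} {{>-nonZero m>0}}

-- Multiplying by `n` turns δ into δn, which `d` dominates; what remains is an inequality of
-- naturals.
clear-δ : ∀ {X V R B n d : ℕ} {δ : ℚ} → 0 < n → δ ℚ.* ℕ→ℚ n ℚ.≤ ℕ→ℚ d →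
  ℕ→ℚ X ℚ.* ℕ→ℚ V ℚ.< (ℕ→ℚ R ℚ.* δ) ℚ.* ℕ→ℚ B → X * V * n < R * d * B
clear-δ {X} {V} {R} {B} {n} {d} {δ} n>0 δn≤d h = ℕ→ℚ-cancel-< (begin-strict
  ℕ→ℚ (X * V * n)                            ≡⟨ trans (ℕ→ℚ-* (X * V) n) (cong (ℚ._* ℕ→ℚ n) (ℕ→ℚ-* X V)) ⟩
  ℕ→ℚ X ℚ.* ℕ→ℚ V ℚ.* ℕ→ℚ n                  <⟨ ℚ.*-monoˡ-<-pos (ℕ→ℚ n) {{ℕ→ℚ-pos n>0}} h ⟩
  (ℕ→ℚ R ℚ.* δ) ℚ.* ℕ→ℚ B ℚ.* ℕ→ℚ n          ≡⟨ ℚ.*-assoc (ℕ→ℚ R ℚ.* δ) (ℕ→ℚ B) (ℕ→ℚ n) ⟩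
  (ℕ→ℚ R ℚ.* δ) ℚ.* (ℕ→ℚ B ℚ.* ℕ→ℚ n)        ≡⟨ cong ((ℕ→ℚ R ℚ.* δ) ℚ.*_) (ℚ.*-comm (ℕ→ℚ B) (ℕ→ℚ n)) ⟩
  (ℕ→ℚ R ℚ.* δ) ℚ.* (ℕ→ℚ n ℚ.* ℕ→ℚ B)        ≡⟨ ℚ.*-assoc (ℕ→ℚ R ℚ.* δ) (ℕ→ℚ n) (ℕ→ℚ B) ⟨
  (ℕ→ℚ R ℚ.* δ) ℚ.* ℕ→ℚ n ℚ.* ℕ→ℚ B          ≡⟨ cong (ℚ._* ℕ→ℚ B) (ℚ.*-assoc (ℕ→ℚ R) δ (ℕ→ℚ n)) ⟩
  ℕ→ℚ R ℚ.* (δ ℚ.* ℕ→ℚ n) ℚ.* ℕ→ℚ B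
    ≤⟨ ℚ.*-monoʳ-≤-nonNeg (ℕ→ℚ B) {{ℕ→ℚ-nonNeg B}} (ℚ.*-monoˡ-≤-nonNeg (ℕ→ℚ R) {{ℕ→ℚ-nonNeg R}} δn≤d) ⟩
  ℕ→ℚ R ℚ.* ℕ→ℚ d ℚ.* ℕ→ℚ B                  ≡⟨ trans (ℕ→ℚ-* (R * d) B) (cong (ℚ._* ℕ→ℚ B) (ℕ→ℚ-* R d)) ⟨
  ℕ→ℚ (R * d * B)                            ∎)
  where open ℚ.≤-Reasoning

2^-grows : ∀ n → n < 2 ^ n
2^-grows zero    = s≤s z≤n
2^-grows (suc n) = ≤-trans (+-mono-≤ (m^n>0 2 n) (2^-grows n)) (≤-reflexive (cong (2 ^ n +_) (sym (+-identityʳ _))))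

-- The factor `n` from clearing δ completes `n ^ p` to a full power of exponent `suc p`.
regroup : ∀ c p a n → (a * (c * n)) ^ suc p ≡ a ^ suc p * (c ^ suc p * n ^ p) * n
regroup c p a n = begin
  (a * (c * n)) ^ suc p             ≡⟨ ^-distribʳ-* (suc p) a (c * n) ⟩
  a ^ suc p * (c * n) ^ suc p       ≡⟨ cong (a ^ suc p *_) (^-distribʳ-* (suc p) c n) ⟩
  a ^ suc p * (c ^ suc p * (n * n ^ p)) ≡⟨ lem (a ^ suc p) (c ^ suc p) n (n ^ p) ⟩
  a ^ suc p * (c ^ suc p * n ^ p) * n ∎
  where
  open ≡-Reasoning
  lem : ∀ x y n z → x * (y * (n * z)) ≡ x * (y * z) * n
  lem = solve-∀

-- If l · b ≤ a, monotonicity of powers would contradict the strict hypothesis; so a < l · b, and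
-- 2^a ≤ (2^l)^b.
logarithm : ∀ c {k a b l n} → 2 ^ l ≤ n →
  (a * (c * n)) ^ k < (c * n * l) ^ k * b ^ k → 2 ^ a ≤ n ^ b
logarithm c {k} {a} {b} {l} {n} 2^l≤n h = begin
  2 ^ a          ≤⟨ ^-monoʳ-≤ 2 (<⇒≤ (≰⇒> λ lb≤a → contradiction h (≤⇒≯ (begin
    (c * n * l) ^ k * b ^ k     ≡⟨ ^-distribʳ-* k (c * n * l) b ⟨
    (c * n * l * b) ^ k         ≤⟨ ^-monoˡ-≤ k (≤-trans (≤-reflexive (*-assoc (c * n) l b))
                                       (≤-trans (*-monoʳ-≤ (c * n) lb≤a) (≤-reflexive (*-comm (c * n) a)))) ⟩
    (a * (c * n)) ^ k           ∎)))) ⟩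
  2 ^ (l * b)    ≡⟨ ^-*-assoc 2 l b ⟨
  (2 ^ l) ^ b    ≤⟨ ^-monoˡ-≤ b 2^l≤n ⟩
  n ^ b          ∎
  where open ≤-Reasoning

mainTheorem2 : ∀ (q : ℕ) → q ≥ 3 →
    Σ ℕ λ C → C ≥ 1 ×
    (∀ (n : ℕ) → n ≥ 2 → ∀ (δ : ℚ) → δ > 0ℚ →
    ∀ (𝒮 : Spanoid n) → IsLCS q δ 𝒮 →
    ∀ (r : ℕ) → IsRank 𝒮 r →
    LeTimesLog2Pow (ℕ→ℚ (r ^ (q ∸ 1)) Data.Rational.* δ)
    (ℕ→ℚ (C ^ (q ∸ 1) * n ^ (q ∸ 2)))
    (q ∸ 1) n)
mainTheorem2 (suc (suc p)) (s≤s (s≤s p≥1)) = 536 , s≤s z≤n , λ where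
  (suc zero) (s≤s ())
  n@(suc (suc _)) n≥2 δ δ>0 𝒮 lcs r rank a b b≥1 h →
    let n>0 = ≤-trans (s≤s z≤n) n≥2
        -- The least family size plays the role of `d`: every family reaches it, and being attained
        -- at `i₀` it is at least δn.
        size i = length (proj₁ (lcs i))
        i₀ , least = argmin size
        k = suc p
        -- The shift makes `suc l` the integer part of the base-2 logarithm of n. It is positive,
        -- and the search may start from 2 ≤ n.
        l , 2^l≤n , n< = bracket (λ j → 2 ^ suc j) n≥2 n (≤-trans (2^-grows n) (m≤n*m (2 ^ n) 2))
        bound = rank-bound 𝒮 k (size i₀) (suc l) r (s≤s z≤n) n>0 (s≤s z≤n) n<
          (λ i → let M , cs , ds , rs , _ = lcs i in M , cs , ds , rs , least i) rank
        cleared = clear-δ {a ^ k} {536 ^ k * n ^ p} {r ^ k} {b ^ k} {n} {size i₀} n>0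
          (proj₂ (proj₂ (proj₂ (proj₂ (lcs i₀))))) h
    in logarithm 536 {k} {a} {b} {suc l} 2^l≤n (≤-trans (≤-reflexive (cong suc (regroup 536 p a n))) (≤-trans cleared (*-monoˡ-≤ (b ^ k) bound)))
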